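{- Let $k,d,n$ be positive integers with $d+1\ge k\ge 2$. Then the finite path $P_n$ is $k,d$-perfect. Moreover, the two-way infinite path $P_\infty$ is also $k,d$-perfect.
   Context: $P_n$ is the path graph on $n$ vertices, and $P_\infty$ is the two-way infinite path with vertex set $\mathbb Z$ (consecutive integers adjacent). All graphs are simple and undirected with nonempty vertex set. A shortest path in a graph $G$ is a path between some vertices $u,v$ (in the same component) whose length (number of edges) equals the graph distance between $u$ and $v$. A set $S\subseteq V(G)$ is $k,d$-independent in $G$ if every shortest path in $G$ of length at most $d$ contains fewer than $k$ vertices of $S$. The $k,d$-chromatic number $\chi^k_d(G)$ is the least positive integer $c$ such that some coloring $V(G)\to\{1,\dots,c\}$ has all color classes $k,d$-independent. A set $S\subseteq V(G)$ is a $k,d$-clique in $G$ if every $k$-element subset of $S$ is contained in some shortest path of $G$ of length at most $d$ (sets with fewer than $k$ elements are vacuously $k,d$-cliques); $\omega^k_d(G)$ is the supremum of the sizes of $k,d$-cliques in $G$. For $2\le k\le d+1$, $G$ is $k,d$-perfect if $\chi^k_d(H)=\left\lceil\frac{\omega^k_d(H)}{k-1}\right\rceil$ for every induced subgraph $H$ of $G$ (shortest paths being computed in $H$). -}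

module Defs where

open import Data.Fin using (Fin; toℕ; fromℕ<)
open import Data.Integer using (ℤ; 0ℤ)
import Data.Integer as ℤ
import Data.Integer.Properties as ℤₚ
open import Data.Irrelevant using ([_])
open import Data.List using (List; []; _∷_; length)
open import Data.List.Membership.Propositional using (_∈_)
open import Data.List.Relation.Unary.All using (All)
open import Data.List.Relation.Unary.Unique.Propositional using (Unique)
open import Data.Nat using (ℕ; suc; pred; _+_; _∸_; _/_; _≤_; _<_; NonZero; >-nonZero; >-nonZero⁻¹)
open import Data.Nat.Properties using (∸-monoˡ-≤; 1+n≢n)
open import Data.Product using (Σ-syntax; _×_; _,_; ∃-syntax)
open import Data.Refinement using (Refinement; value; _,_)
open import Data.Sum using (_⊎_; inj₁; inj₂; swap)
open import Level using (0ℓ)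
open import Relation.Binary.Construct.Closure.ReflexiveTransitive using (Star; ε; _◅_)
open import Relation.Binary.Core using (Rel)
open import Relation.Binary.Definitions using (Symmetric)
open import Relation.Binary.PropositionalEquality using (_≡_; sym)
open import Relation.Nullary using (¬_)
open import Relation.Unary using (Pred; Satisfiable)

record Graph : Set₁ where
  field
    V        : Set
    _~_      : Rel V 0ℓ
    ~-sym    : Symmetric _~_
    ~-irrefl : ∀ {v} → ¬ (v ~ v)
    nonempty : V

-- The refinement type makes the proof of membership irrelevant, so that each
-- member of P gives exactly one vertex.
induced : (G : Graph) (P : Pred (Graph.V G) 0ℓ) → Satisfiable P → Graph
induced G P (v , Pv) = record
  { V        = Refinement V P
  ; _~_      = λ x y → value x ~ value y
  ; ~-sym    = ~-sym
  ; ~-irrefl = ~-irrefl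
  ; nonempty = v , [ Pv ]
  }
  where open Graph G

module _ (G : Graph) where
  open Graph G

  Walk : V → V → Set
  Walk = Star _~_

  walkLength : ∀ {u v} → Walk u v → ℕ
  walkLength ε       = 0
  walkLength (_ ◅ p) = suc (walkLength p)

  vertices : ∀ {u v} → Walk u v → List V
  vertices {u} ε       = u ∷ []
  vertices {u} (_ ◅ p) = u ∷ vertices p

  IsPath : ∀ {u v} → Walk u v → Set
  IsPath p = Unique (vertices p)

  IsDistance : V → V → ℕ → Set
  IsDistance u v n =
    (∃[ p ] walkLength {u} {v} p ≡ n) × (∀ (p : Walk u v) → n ≤ walkLength p)

  IsShortestPath : ∀ {u v} → Walk u v → Set
  IsShortestPath {u} {v} p = IsPath p × IsDistance u v (walkLength p)

  -- The entries of xs form a finite subset of S with length xs elements.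
  _FiniteSubsetOf_ : List V → Pred V 0ℓ → Set
  xs FiniteSubsetOf S = Unique xs × All S xs

  -- Sets need be neither decidable nor finite, so cardinalities are bounded
  -- through the sizes of all finite subsets.
  HasSize≤ HasSize< : Pred V 0ℓ → ℕ → Set
  HasSize≤ S n = ∀ xs → xs FiniteSubsetOf S → length xs ≤ n
  HasSize< S n = ∀ xs → xs FiniteSubsetOf S → length xs < n

  Independent : (k d : ℕ) → Pred V 0ℓ → Set
  Independent k d S = ∀ {u v} (p : Walk u v) → IsShortestPath p → walkLength p ≤ d →
    HasSize< (λ x → x ∈ vertices p × S x) k

  Colorable : (k d c : ℕ) → Set
  Colorable k d c = Σ[ f ∈ (V → Fin c) ] (∀ i → Independent k d (λ v → f v ≡ i))

  IsChromaticNumber : (k d c : ℕ) → Set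
  IsChromaticNumber k d c =
    (1 ≤ c × Colorable k d c) × (∀ c′ → 1 ≤ c′ → Colorable k d c′ → c ≤ c′)

  Clique : (k d : ℕ) → Pred V 0ℓ → Set
  Clique k d S = ∀ xs → xs FiniteSubsetOf S → length xs ≡ k →
    ∃[ u ] ∃[ v ] Σ[ p ∈ Walk u v ]
      (IsShortestPath p × walkLength p ≤ d × All (_∈ vertices p) xs)

  -- The supremum, when it is finite, as a least upper bound.
  IsCliqueNumber : (k d w : ℕ) → Set₁
  IsCliqueNumber k d w =
    IsBound w × (∀ b → IsBound b → w ≤ b)
    where
    IsBound : ℕ → Set₁
    IsBound b = ∀ S → Clique k d S → HasSize≤ S b

⌈_/_⌉ : (m n : ℕ) .{{_ : NonZero n}} → ℕ
⌈ m / n ⌉ = (m + pred n) / n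

k∸1-nonZero : ∀ {k} → 2 ≤ k → NonZero (k ∸ 1)
k∸1-nonZero 2≤k = >-nonZero (∸-monoˡ-≤ 1 2≤k)

-- The equality χ = ⌈ω/(k-1)⌉ includes the existence of both numbers in ℕ.
Perfect : (k d : ℕ) → 2 ≤ k → k ≤ d + 1 → Graph → Set₁
Perfect k d 2≤k _ G = ∀ P (P≠∅ : Satisfiable P) → let H = induced G P P≠∅ in
  Σ[ c ∈ ℕ ] Σ[ w ∈ ℕ ]
    (IsChromaticNumber H k d c × IsCliqueNumber H k d w ×
     c ≡ ⌈ w / (k ∸ 1) ⌉ {{k∸1-nonZero 2≤k}})

path : (n : ℕ) .{{_ : NonZero n}} → Graph
path n = record
  { V        = Fin n
  ; _~_      = λ i j → toℕ j ≡ suc (toℕ i) ⊎ toℕ i ≡ suc (toℕ j)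
  ; ~-sym    = swap
  ; ~-irrefl = λ { (inj₁ e) → 1+n≢n (sym e) ; (inj₂ e) → 1+n≢n (sym e) }
  ; nonempty = fromℕ< (>-nonZero⁻¹ n)
  }

infinitePath : Graph
infinitePath = record
  { V        = ℤ
  ; _~_      = λ i j → j ≡ ℤ.suc i ⊎ i ≡ ℤ.suc j
  ; ~-sym    = swap
  ; ~-irrefl = λ { (inj₁ e) → ℤₚ.i≢suc[i] e ; (inj₂ e) → ℤₚ.i≢suc[i] e }
  ; nonempty = 0ℤ
  }

{-# OPTIONS --safe #-}

-- Let ω be the largest size of a finite k,d-clique.  The vertices of a shortest
-- path of length at most d form a k,d-clique, so such a path has at most ω
-- vertices.  Put c = ⌈ω/(k-1)⌉ and embed the graph in ℤ so that adjacent vertices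
-- are consecutive: residues modulo c(k-1) ≥ ω are distinct along such a path, so
-- cutting ℤ/c(k-1) into c blocks of k-1 residues gives a colouring, whence χ ≤ c.
-- Conversely, in any graph k equally coloured vertices of a k,d-clique would lie
-- on one short shortest path, so c′ colours force ω ≤ c′(k-1).

module Submission where

open import Defs
open import Axiom.ExcludedMiddle using (ExcludedMiddle)
open import Data.Bool using (true; false)
open import Data.Fin using (Fin; toℕ; fromℕ<; combine; remQuot)
open import Data.Fin.Properties
  using (combine-remQuot; fromℕ<-injective; injective⇒≤; toℕ<n; toℕ-injective)
open import Data.Integer using (ℤ; +_; ∣_∣; _/ℕ_; _%ℕ_)
import Data.Integer as ℤ
open import Data.Integer.DivMod using (a≡a%ℕn+[a/ℕn]*n; n%ℕd<d)
import Data.Integer.Properties as ℤₚ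
open import Data.Integer.Tactic.RingSolver using (solve-∀)
open import Data.List using (List; []; _∷_; filter; length; lookup; take)
open import Data.List.Membership.Propositional using (_∈_)
open import Data.List.Membership.Propositional.Properties using (∈-lookup)
open import Data.List.Properties using (length-take)
open import Data.List.Relation.Unary.All as All using (All; []; _∷_)
import Data.List.Relation.Unary.All.Properties as All
open import Data.List.Relation.Unary.AllPairs using ([]; _∷_)
open import Data.List.Relation.Unary.Any using (here; there)
open import Data.List.Relation.Unary.Unique.Propositional using (Unique)
import Data.List.Relation.Unary.Unique.Propositional.Properties as Unique
open import Data.Nat
  using (ℕ; zero; suc; _+_; _*_; _%_; _≤_; _<_; z≤n; s≤s; _≟_; NonZero; >-nonZero)
open import Data.Nat.DivMod using (m%n<n; m<n*o⇒m/o<n; m≡m%n+[m/n]*n)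
open import Data.Nat.Properties
open import Data.Product using (Σ-syntax; ∃-syntax; _×_; _,_; proj₁; proj₂; uncurry)
open import Data.Product.Properties using (×-≡,≡→≡)
open import Data.Refinement using (value; value-injective)
open import Data.Sum using (_⊎_; inj₁; inj₂)
open import Function using (_∘_)
open import Function.Definitions using (Injective)
open import Level using (0ℓ)
open import Relation.Binary.Construct.Closure.ReflexiveTransitive using (ε; _◅_)
open import Relation.Binary.PropositionalEquality
  using (_≡_; _≢_; refl; sym; trans; cong; cong₂; subst; module ≡-Reasoning)
open import Relation.Nullary using (yes; no; contradiction; does)
open import Relation.Unary using (Pred; Decidable; Satisfiable)
open import Relation.Unary.Properties using (∁?)

-- Duplicate-free lists, maxima and rounded-up quotients

lookup-injective : {A : Set} {xs : List A} → Unique xs → Injective _≡_ _≡_ (lookup xs)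
lookup-injective (_  ∷ _) {Fin.zero}  {Fin.zero}  _  = refl
lookup-injective (x∉ ∷ _) {Fin.zero}  {Fin.suc j} eq =
  contradiction eq (All.lookup x∉ (∈-lookup j))
lookup-injective (x∉ ∷ _) {Fin.suc i} {Fin.zero}  eq =
  contradiction (sym eq) (All.lookup x∉ (∈-lookup i))
lookup-injective (_  ∷ u) {Fin.suc i} {Fin.suc j} eq = cong Fin.suc (lookup-injective u eq)

-- Pigeonhole; injectivity is asked for on the entries only, since it will be known only along a
-- short path.
injectiveOn⇒length≤ : {A : Set} {m : ℕ} (g : A → Fin m) {xs : List A} → Unique xs →
  (∀ {x y} → x ∈ xs → y ∈ xs → g x ≡ g y → x ≡ y) → length xs ≤ m
injectiveOn⇒length≤ g {xs} u inj =
  injective⇒≤ {f = g ∘ lookup xs}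
    (λ {i} {j} eq → lookup-injective u (inj (∈-lookup i) (∈-lookup j) eq))

length-filter-∁ : {A : Set} {P : Pred A 0ℓ} (P? : Decidable P) (xs : List A) →
  length xs ≡ length (filter P? xs) + length (filter (∁? P?) xs)
length-filter-∁ P? []       = refl
length-filter-∁ P? (x ∷ xs) with does (P? x)
... | true  = cong suc (length-filter-∁ P? xs)
... | false = trans (cong suc (length-filter-∁ P? xs)) (sym (+-suc _ _))

-- Lower the bound `B` until it is attained. Whether it is attained is the only question put to
-- excluded middle; at 0 the given witness is greatest.
greatest : ExcludedMiddle 0ℓ → (A : ℕ → Set) {a : ℕ} → A a →
  (B : ℕ) → (∀ b → A b → b ≤ B) → ∃[ w ] (A w × (∀ b → A b → b ≤ w))
greatest em A Aa zero    ≤B = _ , Aa , λ b Ab → ≤-trans (≤B b Ab) z≤n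
greatest em A Aa (suc B) ≤B with em {A (suc B)}
... | yes A1+B = suc B , A1+B , ≤B
... | no ¬A1+B = greatest em A Aa B λ b Ab →
  ≤-pred (≤∧≢⇒< (≤B b Ab) λ { refl → ¬A1+B Ab })

-- The remainder is at most n - 1, the amount added for rounding up. With `⌈m/n⌉≤` this makes
-- `⌈ m / n ⌉` the least `c` with `m ≤ c * n`.
m≤⌈m/n⌉*n : ∀ m n .{{_ : NonZero n}} → m ≤ ⌈ m / n ⌉ * n
m≤⌈m/n⌉*n m n@(suc n-1) = +-cancelˡ-≤ n-1 _ _ (begin
  n-1 + m                       ≡⟨ +-comm n-1 m ⟩
  m + n-1                       ≡⟨ m≡m%n+[m/n]*n (m + n-1) n ⟩
  (m + n-1) % n + ⌈ m / n ⌉ * n ≤⟨ +-monoˡ-≤ _ (≤-pred (m%n<n (m + n-1) n)) ⟩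
  n-1 + ⌈ m / n ⌉ * n           ∎)
  where open ≤-Reasoning

⌈m/n⌉≤ : ∀ {m} n {c} .{{_ : NonZero n}} → m ≤ c * n → ⌈ m / n ⌉ ≤ c
⌈m/n⌉≤ {m} n@(suc n-1) {c} m≤cn = ≤-pred (m<n*o⇒m/o<n (begin-strict
  m + n-1   <⟨ +-mono-≤-< m≤cn (n<1+n n-1) ⟩
  c * n + n ≡⟨ +-comm (c * n) n ⟩
  n + c * n ∎))
  where open ≤-Reasoning

-- Residues of integers

residue : (N : ℕ) .{{_ : NonZero N}} → ℤ → Fin N
residue N z = fromℕ< (n%ℕd<d z N)

-- Equal remainders leave a difference `q * N`; an absolute value below `N` forces `q` to be 0.
residue-injective : ∀ N .{{_ : NonZero N}} x y →
  ∣ x ℤ.- y ∣ < N → residue N x ≡ residue N y → x ≡ y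
residue-injective N x y ∣x-y∣<N eq = ℤₚ.i-j≡0⇒i≡j x y (trans x-y≡qN (cong (ℤ._* + N) q≡0))
  where
  q = x /ℕ N ℤ.- y /ℕ N
  cancel : ∀ r a b n → (r ℤ.+ a ℤ.* n) ℤ.- (r ℤ.+ b ℤ.* n) ≡ (a ℤ.- b) ℤ.* n
  cancel = solve-∀
  x-y≡qN : x ℤ.- y ≡ q ℤ.* + N
  x-y≡qN = begin
    x ℤ.- y
      ≡⟨ cong₂ ℤ._-_ (a≡a%ℕn+[a/ℕn]*n x N) (a≡a%ℕn+[a/ℕn]*n y N) ⟩
    (+ (x %ℕ N) ℤ.+ x /ℕ N ℤ.* + N) ℤ.- (+ (y %ℕ N) ℤ.+ y /ℕ N ℤ.* + N)
      ≡⟨ cong (λ r → (+ r ℤ.+ x /ℕ N ℤ.* + N) ℤ.- _) (fromℕ<-injective _ _ _ _ eq) ⟩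
    (+ (y %ℕ N) ℤ.+ x /ℕ N ℤ.* + N) ℤ.- (+ (y %ℕ N) ℤ.+ y /ℕ N ℤ.* + N)
      ≡⟨ cancel (+ (y %ℕ N)) (x /ℕ N) (y /ℕ N) (+ N) ⟩
    q ℤ.* + N ∎
    where open ≡-Reasoning
  ∣q∣*N<1*N : ∣ q ∣ * N < 1 * N
  ∣q∣*N<1*N = begin-strict
    ∣ q ∣ * N       ≡⟨ ℤₚ.abs-* q (+ N) ⟨
    ∣ q ℤ.* + N ∣   ≡⟨ cong ∣_∣ x-y≡qN ⟨
    ∣ x ℤ.- y ∣     <⟨ ∣x-y∣<N ⟩
    N               ≡⟨ *-identityˡ N ⟨
    1 * N           ∎
    where open ≤-Reasoning
  q≡0 : q ≡ + 0
  q≡0 = ℤₚ.∣i∣≡0⇒i≡0 (n<1⇒n≡0 (*-cancelʳ-< N ∣ q ∣ 1 ∣q∣*N<1*N))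

∣suc[i]-i∣≡1 : ∀ i → ∣ ℤ.suc i ℤ.- i ∣ ≡ 1
∣suc[i]-i∣≡1 i = cong ∣_∣ (suc-cancel i)
  where
  suc-cancel : ∀ a → (+ 1 ℤ.+ a) ℤ.- a ≡ + 1
  suc-cancel = solve-∀

-- Cliques and colourings in an arbitrary graph

module _ (G : Graph) where
  open Graph G

  -- Induction on `c`, splitting off the fibre over the largest value. The lists are filtered by the
  -- value of `f`, as `S` need not be decidable.
  hasSize≤-fibres : ∀ {m} c (S : Pred V 0ℓ) (f : V → ℕ) → (∀ {x} → S x → f x < c) →
    (∀ i → HasSize≤ G (λ x → S x × f x ≡ i) m) → HasSize≤ G S (c * m)
  hasSize≤-fibres zero    S f f<c fib []       _             = z≤n
  hasSize≤-fibres zero    S f f<c fib (x ∷ xs) (_ , Sx ∷ _)  = contradiction (f<c Sx) λ ()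
  hasSize≤-fibres {m} (suc c) S f f<c fib xs (u , Sxs) = begin
    length xs
      ≡⟨ length-filter-∁ P? xs ⟩
    length (filter P? xs) + length (filter (∁? P?) xs)
      ≤⟨ +-mono-≤
           (fib c _ (Unique.filter⁺ P? u ,
             All.zip (All.filter⁺ P? Sxs , All.all-filter P? xs)))
           (hasSize≤-fibres c (λ x → S x × f x ≢ c) f
             (λ (Sx , fx≢c) → ≤∧≢⇒< (≤-pred (f<c Sx)) fx≢c)
             (λ i ys (uys , Sys) → fib i ys (uys , All.map (λ ((Sy , _) , e) → Sy , e) Sys))
             _ (Unique.filter⁺ (∁? P?) u ,
               All.zip (All.filter⁺ (∁? P?) Sxs , All.all-filter (∁? P?) xs))) ⟩
    m + c * m ∎
    where
    open ≤-Reasoning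
    P? = λ x → f x ≟ c

  -- Only finite cliques are considered, since excluded middle at level 0 does
  -- not apply to a quantification over all predicates.
  HasCliqueOfSize : (k d b : ℕ) → Set
  HasCliqueOfSize k d b = Σ[ xs ∈ List V ] (Unique xs × length xs ≡ b × Clique G k d (_∈ xs))

  -- Subsets of cliques are cliques, so a bound on list cliques bounds cliques given by arbitrary
  -- predicates.
  clique⇒hasCliqueOfSize : ∀ {k d S xs} → Clique G k d S → _FiniteSubsetOf_ G xs S →
    HasCliqueOfSize k d (length xs)
  clique⇒hasCliqueOfSize {xs = xs} cl (u , Sxs) =
    xs , u , refl , λ ys (uys , ys⊆xs) → cl ys (uys , All.map (All.lookup Sxs) ys⊆xs)

  length-vertices : ∀ {u v} (p : Walk G u v) → length (vertices G p) ≡ suc (walkLength G p)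
  length-vertices ε       = refl
  length-vertices (_ ◅ p) = cong suc (length-vertices p)

  shortestPath⇒hasCliqueOfSize : ∀ {k d u v} (p : Walk G u v) → IsShortestPath G p →
    walkLength G p ≤ d → HasCliqueOfSize k d (suc (walkLength G p))
  shortestPath⇒hasCliqueOfSize p sp p≤d =
    vertices G p , proj₁ sp , length-vertices p ,
    λ ys (_ , ys∈p) _ → _ , _ , p , sp , p≤d , ys∈p

  hasCliqueOfSize-1 : ∀ {k d} → HasCliqueOfSize k d 1
  hasCliqueOfSize-1 = shortestPath⇒hasCliqueOfSize (ε {x = nonempty})
    ([] ∷ [] , (ε , refl) , λ _ → z≤n) z≤n

  colorable⇒cliqueSize≤ : ∀ {m d c b} → Colorable G (suc m) d c →
    HasCliqueOfSize (suc m) d b → b ≤ c * m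
  colorable⇒cliqueSize≤ {m} {d} {c} (f , ind) (xs , u , refl , cl) =
    hasSize≤-fibres c (_∈ xs) (toℕ ∘ f) (λ {x} _ → toℕ<n (f x)) fibre xs
      (u , All.tabulate (λ x∈ → x∈))
    where
    fibre : ∀ i → HasSize≤ G (λ x → x ∈ xs × toℕ (f x) ≡ i) m
    fibre i []       _           = z≤n
    fibre i ys@(y ∷ _) (uys , ys∈) = ≮⇒≥ λ m<∣ys∣ →
      -- The clique condition speaks of exactly `suc m` vertices, so an overlong fibre is truncated.
      let zs       = take (suc m) ys
          uzs      = Unique.take⁺ (suc m) uys
          zs∈      = All.take⁺ (suc m) ys∈
          ∣zs∣≡1+m = trans (length-take (suc m) ys) (m≤n⇒m⊓n≡m m<∣ys∣)
          _ , _ , p , sp , p≤d , zs∈p = cl zs (uzs , All.map proj₁ zs∈) ∣zs∣≡1+m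
          fy≡i = proj₂ (All.head ys∈)
          sameColour = All.map (λ (_ , e) → toℕ-injective (trans e (sym fy≡i))) zs∈
      in <-irrefl ∣zs∣≡1+m (ind (f y) p sp p≤d zs (uzs , All.zip (zs∈p , sameColour)))

  -- `remQuot m` splits `ρ x` into a block, used as the colour, and an offset in `Fin m`. Within one
  -- colour on a short path the offset determines the vertex, so at most `m` occur.
  injectiveOnShortPaths⇒colorable : ∀ {m d c} (ρ : V → Fin (c * m)) →
    (∀ {u v} (p : Walk G u v) → IsShortestPath G p → walkLength G p ≤ d →
      ∀ {x y} → x ∈ vertices G p → y ∈ vertices G p → ρ x ≡ ρ y → x ≡ y) →
    Colorable G (suc m) d c
  injectiveOnShortPaths⇒colorable {m} {d} {c} ρ ρ-inj =
    proj₁ ∘ remQuot m ∘ ρ , λ i p sp p≤d xs (u , xs∈) →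
      s≤s (injectiveOn⇒length≤ (proj₂ ∘ remQuot {c} m ∘ ρ) u λ x∈ y∈ eq →
        let x∈p , fx≡i = All.lookup xs∈ x∈
            y∈p , fy≡i = All.lookup xs∈ y∈
        in ρ-inj p sp p≤d x∈p y∈p
             (remQuot-injective (×-≡,≡→≡ (trans fx≡i (sym fy≡i) , eq))))
    where
    remQuot-injective : Injective _≡_ _≡_ (remQuot {c} m)
    remQuot-injective {a} {b} eq = trans (sym (combine-remQuot {c} m a))
      (trans (cong (uncurry combine) eq) (combine-remQuot {c} m b))

-- Graphs laid out along ℤ

record LinearEmbedding (G : Graph) : Set where
  open Graph G
  field
    position           : V → ℤ
    position-injective : Injective _≡_ _≡_ position
    ~⇒consecutive      : ∀ {u v} → u ~ v →
      position v ≡ ℤ.suc (position u) ⊎ position u ≡ ℤ.suc (position v)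

module _ {G : Graph} (L : LinearEmbedding G) where
  open Graph G
  open LinearEmbedding L

  separation : V → V → ℕ
  separation x y = ∣ position x ℤ.- position y ∣

  separation-comm : ∀ x y → separation x y ≡ separation y x
  separation-comm x y = ℤₚ.∣i-j∣≡∣j-i∣ (position x) (position y)

  separation-refl : ∀ x → separation x x ≡ 0
  separation-refl x = cong ∣_∣ (ℤₚ.+-inverseʳ (position x))

  separation-triangle : ∀ x y z → separation x z ≤ separation x y + separation y z
  separation-triangle x y z = subst (λ a → ∣ a ∣ ≤ separation x y + separation y z)
    (telescope (position x) (position y) (position z))
    (ℤₚ.∣i+j∣≤∣i∣+∣j∣ (position x ℤ.- position y) (position y ℤ.- position z))
    where
    telescope : ∀ a b c → (a ℤ.- b) ℤ.+ (b ℤ.- c) ≡ a ℤ.- c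
    telescope = solve-∀

  ~⇒separation≡1 : ∀ {u v} → u ~ v → separation u v ≡ 1
  ~⇒separation≡1 {u} {v} u~v with ~⇒consecutive u~v
  ... | inj₁ e rewrite separation-comm u v | e = ∣suc[i]-i∣≡1 (position u)
  ... | inj₂ e rewrite e = ∣suc[i]-i∣≡1 (position v)

  separation-start≤ : ∀ {u v x} (p : Walk G u v) → x ∈ vertices G p →
    separation u x ≤ walkLength G p
  separation-start≤ {u} ε       (here refl) = ≤-reflexive (separation-refl u)
  separation-start≤ {u} (_ ◅ p) (here refl) = ≤-trans (≤-reflexive (separation-refl u)) z≤n
  separation-start≤ {u} {x = x} (_◅_ {j = w} u~w p) (there x∈p) = ≤-trans
    (separation-triangle u w x)
    (+-mono-≤ (≤-reflexive (~⇒separation≡1 u~w)) (separation-start≤ p x∈p))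

  separation≤ : ∀ {u v x y} (p : Walk G u v) → x ∈ vertices G p → y ∈ vertices G p →
    separation x y ≤ walkLength G p
  separation≤ p@ε       (here refl) y∈p         = separation-start≤ p y∈p
  separation≤ p@(_ ◅ _) (here refl) y∈p         = separation-start≤ p y∈p
  separation≤ {x = x} {y} p@(_ ◅ _) x∈p@(there _) (here refl) =
    ≤-trans (≤-reflexive (separation-comm x y)) (separation-start≤ p x∈p)
  separation≤ (_ ◅ p) (there x∈p) (there y∈p) = m≤n⇒m≤1+n (separation≤ p x∈p y∈p)

  -- The length bound is a hypothesis because the lemma serves twice: with `suc d` colours for a
  -- crude bound, then with the optimal `c`.
  linear⇒colorable : ∀ {m d c} .{{_ : NonZero c}} .{{_ : NonZero m}} →
    (∀ {u v} (p : Walk G u v) → IsShortestPath G p → walkLength G p ≤ d →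
      walkLength G p < c * m) →
    Colorable G (suc m) d c
  linear⇒colorable {m} {d} {c} short =
    injectiveOnShortPaths⇒colorable G {c = c} (residue (c * m) ∘ position)
      λ p sp p≤d {x} {y} x∈p y∈p eq → position-injective
        (residue-injective (c * m) (position x) (position y)
          (≤-<-trans (separation≤ p x∈p y∈p) (short p sp p≤d)) eq)
    where instance _ = m*n≢0 c m

  chromaticNumber-cliqueNumber : ExcludedMiddle 0ℓ → ∀ m d .{{_ : NonZero m}} →
    Σ[ c ∈ ℕ ] Σ[ w ∈ ℕ ] (IsChromaticNumber G (suc m) d c ×
      IsCliqueNumber G (suc m) d w × c ≡ ⌈ w / m ⌉)
  chromaticNumber-cliqueNumber em m d =
    c , w ,
    ((1≤c , linear⇒colorable {c = c} {{>-nonZero 1≤c}} λ p sp p≤d →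
        -- A path of length ℓ gives a clique of ℓ + 1 vertices, so ℓ + 1 ≤ w ≤ c * m, which is the
        -- strict inequality wanted.
        ≤-trans (w-max _ (shortestPath⇒hasCliqueOfSize G p sp p≤d)) (m≤⌈m/n⌉*n w m)) ,
      λ c′ _ col → ⌈m/n⌉≤ m (colorable⇒cliqueSize≤ G col w-clique)) ,
    ((λ S cl xs xs⊆S → w-max _ (clique⇒hasCliqueOfSize G {S = S} cl xs⊆S)) ,
      λ b b-bound → w≤ b b-bound w-clique) ,
    refl
    where
    A = HasCliqueOfSize G (suc m) d
    -- `suc d` colours always suffice, since lengths up to `d` stay below the modulus; this gives
    -- the a priori bound on clique sizes that `greatest` requires.
    crude : Colorable G (suc m) d (suc d)
    crude = linear⇒colorable λ p _ p≤d → ≤-trans (s≤s p≤d) (m≤m*n (suc d) m)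
    max = greatest em A (hasCliqueOfSize-1 G) (suc d * m)
      (λ b → colorable⇒cliqueSize≤ G crude)
    w = proj₁ max
    w-clique = proj₁ (proj₂ max)
    w-max = proj₂ (proj₂ max)
    c = ⌈ w / m ⌉
    -- A single vertex is a clique, so `w` is at least 1, whereas `c` = 0 would give `w ≤ 0`.
    1≤c : 1 ≤ c
    1≤c = n≢0⇒n>0 λ c≡0 → contradiction
      (≤-trans (w-max 1 (hasCliqueOfSize-1 G))
        (subst (λ a → w ≤ a * m) c≡0 (m≤⌈m/n⌉*n w m))) λ ()
    -- A list clique is also a clique as the predicate `_∈ xs`, so every bound over predicates
    -- applies to it.
    w≤ : ∀ b → (∀ S → Clique G (suc m) d S → HasSize≤ G S b) → ∀ {a} → A a → a ≤ b
    w≤ b b-bound (xs , u , refl , cl) = b-bound (_∈ xs) cl xs (u , All.tabulate (λ x∈ → x∈))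

-- Induced subgraphs and the two kinds of paths

induced-linear : ∀ {G} → LinearEmbedding G → ∀ P (P≠∅ : Satisfiable P) →
  LinearEmbedding (induced G P P≠∅)
induced-linear L P P≠∅ = record
  { position           = position ∘ value
  ; position-injective = value-injective ∘ position-injective
  ; ~⇒consecutive      = ~⇒consecutive
  }
  where open LinearEmbedding L

linear⇒perfect : ExcludedMiddle 0ℓ → ∀ k d (2≤k : 2 ≤ k) (k≤d+1 : k ≤ d + 1) {G : Graph} →
  LinearEmbedding G → Perfect k d 2≤k k≤d+1 G
-- Matching `k` as `suc m` with `m` a successor makes `k ∸ 1` reduce to `m` and shows `m` nonzero.
linear⇒perfect em (suc m@(suc _)) d (s≤s (s≤s _)) _ L P P≠∅ =
  chromaticNumber-cliqueNumber (induced-linear L P P≠∅) em m d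

path-linear : ∀ n .{{_ : NonZero n}} → LinearEmbedding (path n)
path-linear n = record
  { position           = +_ ∘ toℕ
  ; position-injective = toℕ-injective ∘ ℤₚ.+-injective
  ; ~⇒consecutive      = λ { (inj₁ e) → inj₁ (cong +_ e) ; (inj₂ e) → inj₂ (cong +_ e) }
  }

infinitePath-linear : LinearEmbedding infinitePath
infinitePath-linear = record
  { position           = λ z → z
  ; position-injective = λ e → e
  ; ~⇒consecutive      = λ e → e
  }

corollary4p5 : ExcludedMiddle 0ℓ →
    ∀ (k d : ℕ) (2≤k : 2 ≤ k) (k≤d+1 : k ≤ d + 1) →
    (∀ (n : ℕ) .{{_ : NonZero n}} → Perfect k d 2≤k k≤d+1 (path n))
    × Perfect k d 2≤k k≤d+1 infinitePath
corollary4p5 em k d 2≤k k≤d+1 =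
  (λ n → linear⇒perfect em k d 2≤k k≤d+1 (path-linear n)) ,
  linear⇒perfect em k d 2≤k k≤d+1 infinitePath-linear
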